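{- Let $r \in \mathbb{Z}_{\geqslant 2}$. For any real number $x \geqslant 1$, $$\sum_{n_1 \leqslant x, \dotsc, n_r \leqslant x} \mu \left( n_1 \dotsb n_r \right) \left \lfloor \frac{x}{n_1 \dotsb n_r} \right \rfloor = \sum_{n \leqslant x} (1-r)^{\omega(n)},$$ where the sum on the left runs over all $r$-tuples of positive integers $n_1,\dots,n_r \leqslant x$.
   Context: $\mu$ is the Möbius function, $\omega(n)$ is the number of distinct prime factors of $n$ (with $\omega(1)=0$), and $\lfloor \cdot \rfloor$ is the integer part. -}

module Defs where

import Algebra.Properties.Group as Group
open import Axiom.ExcludedMiddle using (ExcludedMiddle)
open import Data.Empty using (⊥-elim)
open import Data.Integer as ℤ using (ℤ; +_; 0ℤ; 1ℤ; -1ℤ)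
import Data.Integer.Properties as ℤ
open import Data.List using (List; []; _∷_; map; foldr; filter; length; upTo; cartesianProductWith)
open import Data.List.Membership.Propositional using (_∈_)
open import Data.List.Membership.Propositional.Properties
  using (∈-filter⁺; ∈-filter⁻; ∈-map⁺; ∈-upTo⁺)
open import Data.List.Relation.Unary.Unique.Propositional using (Unique)
import Data.List.Relation.Unary.Unique.Propositional.Properties as Unique
open import Data.Nat as ℕ using (ℕ; zero; suc; NonZero)
import Data.Nat.Coprimality as Coprime
open import Data.Nat.Divisibility using (_∣_; _∣?_; ∣⇒≤)
open import Data.Nat.Primality using (Prime; prime?; prime⇒nonZero)
import Data.Nat.Properties as ℕ
open import Data.Product using (∃; _×_; _,_; proj₁; proj₂)
open import Data.Rational as ℚ using (ℚ; mkℚ; ↥_; ↧_; _/_)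
import Data.Rational.Properties as ℚ
open import Data.Sum using (_⊎_; inj₁; inj₂)
open import Data.Vec as Vec using (Vec; []; _∷_)
open import Function using (_∘_; _⇔_; mk⇔)
open import Level using (0ℓ)
open import Relation.Binary.PropositionalEquality using (_≡_; refl; sym; trans; cong; subst; subst₂)
open import Relation.Nullary using (¬_; Dec; yes; no; ¬?; _→-dec_)
open import Relation.Nullary.Decidable using (map′; _×-dec_)

record ℕ⁺ : Set where
  constructor mkℕ⁺
  field
    value       : ℕ
    ⦃ nonZero ⦄ : NonZero value

open ℕ⁺ public using (value)

1⁺ : ℕ⁺
1⁺ = mkℕ⁺ 1

infixl 7 _*⁺_

_*⁺_ : ℕ⁺ → ℕ⁺ → ℕ⁺
mkℕ⁺ m *⁺ mkℕ⁺ n = mkℕ⁺ (m ℕ.* n) ⦃ ℕ.m*n≢0 m n ⦄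

∏ : ∀ {r} → Vec ℕ⁺ r → ℕ⁺
∏ = Vec.foldr _ _*⁺_ 1⁺

-- Every prime factor of n is at most n, so it occurs in upTo (suc n).
ω : ℕ⁺ → ℕ
ω (mkℕ⁺ n) = length (filter (λ p → prime? p ×-dec p ∣? n) (upTo (suc n)))

SquareFree : ℕ⁺ → Set
SquareFree n = ∀ {p} → Prime p → ¬ (p ℕ.* p ∣ value n)

squareFree? : ∀ n → Dec (SquareFree n)
squareFree? (mkℕ⁺ n) = map′ to′ (λ f _ → f)
  (ℕ.allUpTo? (λ p → prime? p →-dec ¬? (p ℕ.* p ∣? n)) (suc n))
  where
  bound : ∀ {p} → Prime p → p ℕ.* p ∣ n → p ℕ.< suc n
  bound {p} pp d = ℕ.s≤s (ℕ.≤-trans (ℕ.m≤m*n p p ⦃ prime⇒nonZero pp ⦄) (∣⇒≤ d))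

  to′ : (∀ {p} → p ℕ.< suc n → Prime p → ¬ (p ℕ.* p ∣ n)) → SquareFree (mkℕ⁺ n)
  to′ f pp d = f (bound pp d) pp d

μ : ℕ⁺ → ℤ
μ n with squareFree? n
... | yes _ = -1ℤ ℤ.^ ω n
... | no  _ = 0ℤ

∑ : {A : Set} → List A → (A → ℤ) → ℤ
∑ xs f = foldr ℤ._+_ 0ℤ (map f xs)

infix 3 ∑
syntax ∑ xs (λ n → e) = ∑[ n ∈ xs ] e

tuples : {A : Set} (r : ℕ) → List A → List (Vec A r)
tuples zero    xs = [] ∷ []
tuples (suc r) xs = cartesianProductWith _∷_ xs (tuples r xs)

-- Two-sided Dedekind cuts: lower q means q < x, and upper q means x < q.
record ℝ : Set₁ where
  field
    lower upper     : ℚ → Set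
    lower-inhabited : ∃ lower
    upper-inhabited : ∃ upper
    lower-rounded   : ∀ q → lower q ⇔ ∃ λ s → q ℚ.< s × lower s
    upper-rounded   : ∀ q → upper q ⇔ ∃ λ s → s ℚ.< q × upper s
    disjoint        : ∀ q → ¬ (lower q × upper q)
    located         : ∀ {q s} → q ℚ.< s → lower q ⊎ upper s

open ℝ
open Function.Equivalence using (to; from)

infix 4 _≤_ _<_

_≤_ : ℝ → ℝ → Set
x ≤ y = ∀ q → lower x q → lower y q

_<_ : ℝ → ℝ → Set
x < y = ∃ λ q → upper x q × lower y q

fromℚ : ℚ → ℝ
fromℚ p = record
  { lower           = ℚ._< p
  ; upper           = p ℚ.<_
  ; lower-inhabited = p ℚ.- ℚ.1ℚ , subst (p ℚ.- ℚ.1ℚ ℚ.<_) (ℚ.+-identityʳ p)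
                        (ℚ.+-monoʳ-< p (ℚ.negative⁻¹ (ℚ.- ℚ.1ℚ)))
  ; upper-inhabited = p ℚ.+ ℚ.1ℚ , subst (ℚ._< p ℚ.+ ℚ.1ℚ) (ℚ.+-identityʳ p)
                        (ℚ.+-monoʳ-< p (ℚ.positive⁻¹ ℚ.1ℚ))
  ; lower-rounded   = λ q → mk⇔ ℚ.<-dense (λ (_ , q<s , s<p) → ℚ.<-trans q<s s<p)
  ; upper-rounded   = λ q → mk⇔
      (λ p<q → let s , p<s , s<q = ℚ.<-dense p<q in s , s<q , p<s)
      (λ (_ , s<q , p<s) → ℚ.<-trans p<s s<q)
  ; disjoint        = λ q (q<p , p<q) → ℚ.<-asym q<p p<q
  ; located         = λ {q} {s} q<s → located′ q<s
  }
  where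
  located′ : ∀ {q s} → q ℚ.< s → q ℚ.< p ⊎ p ℚ.< s
  located′ {q} q<s with q ℚ.<? p
  ... | yes q<p = inj₁ q<p
  ... | no  q≮p = inj₂ (ℚ.≤-<-trans (ℚ.≮⇒≥ q≮p) q<s)

fromℤ : ℤ → ℝ
fromℤ i = fromℚ (i / 1)

fromℕ : ℕ → ℝ
fromℕ n = fromℤ (+ n)

-- For a positive integer n, q < x / n iff q * n < x, and x / n < q iff x < q * n.
infixl 7 _÷_

_÷_ : ℝ → ℕ⁺ → ℝ
x ÷ mkℕ⁺ n = record
  { lower           = lower x ∘ (ℚ._* N)
  ; upper           = upper x ∘ (ℚ._* N)
  ; lower-inhabited = let q , l = lower-inhabited x in q ℚ.÷ N , subst (lower x) (sym (cancel q)) l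
  ; upper-inhabited = let q , u = upper-inhabited x in q ℚ.÷ N , subst (upper x) (sym (cancel q)) u
  ; lower-rounded   = λ q → mk⇔
      (λ l → let s , qN<s , ls = to (lower-rounded x _) l in
             s ℚ.÷ N
           , ℚ.*-cancelʳ-<-nonNeg N (subst (q ℚ.* N ℚ.<_) (sym (cancel s)) qN<s)
           , subst (lower x) (sym (cancel s)) ls)
      (λ (s , q<s , ls) → from (lower-rounded x _) (s ℚ.* N , ℚ.*-monoˡ-<-pos N q<s , ls))
  ; upper-rounded   = λ q → mk⇔
      (λ u → let s , s<qN , us = to (upper-rounded x _) u in
             s ℚ.÷ N
           , ℚ.*-cancelʳ-<-nonNeg N (subst (ℚ._< q ℚ.* N) (sym (cancel s)) s<qN)
           , subst (upper x) (sym (cancel s)) us)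
      (λ (s , s<q , us) → from (upper-rounded x _) (s ℚ.* N , ℚ.*-monoˡ-<-pos N s<q , us))
  ; disjoint        = λ q → disjoint x (q ℚ.* N)
  ; located         = λ q<s → located x (ℚ.*-monoˡ-<-pos N q<s)
  }
  where
  N : ℚ
  N = + n / 1

  instance
    N-pos : ℚ.Positive N
    N-pos = ℚ.normalize-pos n 1

    N-nonNeg : ℚ.NonNegative N
    N-nonNeg = ℚ.pos⇒nonNeg N

    N-nonZero : ℚ.NonZero N
    N-nonZero = ℚ.pos⇒nonZero N

  cancel : ∀ q → (q ℚ.÷ N) ℚ.* N ≡ q
  cancel q = trans (ℚ.*-assoc q (ℚ.1/ N) N)
            (trans (cong (q ℚ.*_) (ℚ.*-inverseˡ N)) (ℚ.*-identityʳ q))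

i/1≡ : ∀ i → i / 1 ≡ mkℚ i 0 (Coprime.sym (Coprime.1-coprimeTo _))
i/1≡ i = ℚ.↥p/↧p≡p (mkℚ i 0 (Coprime.sym (Coprime.1-coprimeTo _)))

bound : ℚ → ℕ
bound q = suc ℤ.∣ ↥ q ∣

<bound : ∀ q → q ℚ.< + bound q / 1
<bound q@(mkℚ p d _) = subst (q ℚ.<_) (sym (i/1≡ (+ bound q))) (ℚ.*<* p*1<)
  where
  open ℤ.≤-Reasoning
  p≤∣p∣ : ∀ p → p ℤ.≤ + ℤ.∣ p ∣
  p≤∣p∣ (+ _)        = ℤ.≤-refl
  p≤∣p∣ (ℤ.-[1+ _ ]) = ℤ.-≤+
  p*1< : p ℤ.* 1ℤ ℤ.< + bound q ℤ.* + suc d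
  p*1< = begin-strict
    p ℤ.* 1ℤ               ≡⟨ ℤ.*-identityʳ p ⟩
    p                      ≤⟨ p≤∣p∣ p ⟩
    + ℤ.∣ p ∣              <⟨ ℤ.+<+ (ℕ.n<1+n _) ⟩
    + bound q              ≤⟨ ℤ.+≤+ (ℕ.m≤m*n (bound q) (suc d)) ⟩
    + (bound q ℕ.* suc d)  ≡⟨ ℤ.pos-* (bound q) (suc d) ⟩
    + bound q ℤ.* + suc d  ∎

-bound< : ∀ q → ℤ.- (+ bound q) / 1 ℚ.< q
-bound< q = subst (ℤ.- (+ bound q) / 1 ℚ.<_) (Group.⁻¹-involutive ℚ.+-0-group q)
  (subst (λ k → ℤ.- (+ suc k) / 1 ℚ.< ℚ.- (ℚ.- q)) (∣↥-∣ q)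
    (ℚ.neg-antimono-< (<bound (ℚ.- q))))
  where
  ∣↥-∣ : ∀ q → ℤ.∣ ↥ (ℚ.- q) ∣ ≡ ℤ.∣ ↥ q ∣
  ∣↥-∣ q = trans (cong ℤ.∣_∣ (ℚ.↥-neg q)) (ℤ.∣-i∣≡∣i∣ (↥ q))

/1-cancel-< : ∀ {i j} → i / 1 ℚ.< j / 1 → i ℤ.< j
/1-cancel-< {i} {j} i<j =
  subst₂ ℤ._<_ (ℤ.*-identityʳ i) (ℤ.*-identityʳ j)
    (ℚ.drop-*<* (subst₂ ℚ._<_ (i/1≡ i) (i/1≡ j) i<j))

≤-<-absurd : ∀ x y → x ≤ y → ¬ (y < x)
≤-<-absurd x y x≤y (q , u , l) = disjoint y q (x≤y q l , u)

≮fromℚ⇒≥ : ∀ y p → ¬ (y < fromℚ p) → fromℚ p ≤ y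
≮fromℚ⇒≥ y p y≮p q q<p with located y q<p
... | inj₁ l = l
... | inj₂ u = let s , s<p , us = to (upper-rounded y p) u in ⊥-elim (y≮p (s , us , s<p))

ceilingBound : ℝ → ℕ
ceilingBound x = bound (proj₁ (upper-inhabited x))

<ceilingBound : ∀ x → x < fromℕ (ceilingBound x)
<ceilingBound x = let q , u = upper-inhabited x in q , u , <bound q

fromℕ≤⇒<ceilingBound : ∀ x n → fromℕ n ≤ x → n ℕ.< ceilingBound x
fromℕ≤⇒<ceilingBound x n n≤x with n ℕ.<? ceilingBound x
... | yes n<b = n<b
... | no  n≮b with <ceilingBound x
...   | q , u , q<b with q ℚ.<? (+ n / 1)
...     | yes q<n = ⊥-elim (disjoint x q (n≤x q q<n , u))
...     | no  q≮n = ⊥-elim (n≮b (ℤ.drop‿+<+ (/1-cancel-< (ℚ.≤-<-trans (ℚ.≮⇒≥ q≮n) q<b))))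

-- On all of ℝ, the integer part and the finite list of positive integers n ≤ x
-- exist only classically, so they are parameterised by excluded middle.

IsFloor : ℝ → ℤ → Set
IsFloor y m = fromℤ m ≤ y × y < fromℤ (m ℤ.+ 1ℤ)

module Classical (em : ExcludedMiddle 0ℓ) where

  floor : ∀ y → ∃ (IsFloor y)
  floor y = search (bound q ℕ.+ ceilingBound y) lo lo≤y
              (subst (λ i → y < fromℤ i) (sym lo+steps) (<ceilingBound y))
    where
    q : ℚ
    q = proj₁ (lower-inhabited y)

    lo : ℤ
    lo = ℤ.- (+ bound q)

    lo≤y : fromℤ lo ≤ y
    lo≤y s s<lo = from (lower-rounded y s)
      (q , ℚ.<-trans s<lo (-bound< q) , proj₂ (lower-inhabited y))

    lo+steps : lo ℤ.+ + (bound q ℕ.+ ceilingBound y) ≡ + ceilingBound y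
    lo+steps = trans (sym (ℤ.+-assoc lo (+ bound q) (+ ceilingBound y)))
              (trans (cong (ℤ._+ + ceilingBound y) (ℤ.+-inverseˡ (+ bound q)))
                     (ℤ.+-identityˡ (+ ceilingBound y)))

    search : ∀ k m → fromℤ m ≤ y → y < fromℤ (m ℤ.+ + k) → ∃ (IsFloor y)
    search zero    m m≤y y<m = ⊥-elim (≤-<-absurd (fromℤ m) y m≤y
      (subst (λ i → y < fromℤ i) (ℤ.+-identityʳ m) y<m))
    search (suc k) m m≤y y<m+k with em {y < fromℤ (m ℤ.+ 1ℤ)}
    ... | yes y<m+1 = m , m≤y , y<m+1
    ... | no  y≮m+1 = search k (m ℤ.+ 1ℤ) (≮fromℚ⇒≥ y _ y≮m+1)
      (subst (λ i → y < fromℤ i) (sym (ℤ.+-assoc m 1ℤ (+ k))) y<m+k)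

  ⌊_⌋ : ℝ → ℤ
  ⌊ y ⌋ = proj₁ (floor y)

  candidates : ℝ → List ℕ⁺
  candidates x = map (λ k → mkℕ⁺ (suc k)) (upTo (ceilingBound x))

  _≤?_ : ∀ n x → Dec (fromℕ (value n) ≤ x)
  n ≤? x = em

  positives≤ : ℝ → List ℕ⁺
  positives≤ x = filter (_≤? x) (candidates x)

  ∈-positives≤ : ∀ x n → n ∈ positives≤ x ⇔ fromℕ (value n) ≤ x
  ∈-positives≤ x n = mk⇔ (λ n∈ → proj₂ (∈-filter⁻ (_≤? x) {xs = candidates x} n∈)) (complete n)
    where
    complete : ∀ n → fromℕ (value n) ≤ x → n ∈ positives≤ x
    complete (mkℕ⁺ (suc k)) n≤x = ∈-filter⁺ (_≤? x)
      (∈-map⁺ (λ k → mkℕ⁺ (suc k))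
        (∈-upTo⁺ (ℕ.<-trans (ℕ.n<1+n k) (fromℕ≤⇒<ceilingBound x (suc k) n≤x)))) n≤x

  positives≤-unique : ∀ x → Unique (positives≤ x)
  positives≤-unique x = Unique.filter⁺ (_≤? x)
    (Unique.map⁺ (ℕ.suc-injective ∘ cong value) (Unique.upTo⁺ (ceilingBound x)))

{-# OPTIONS --safe #-}

-- Since ⌊x / d⌋ counts the multiples of d up to x, exchanging the sums reduces the theorem to
--   ∑ [n₁ ⋯ nᵣ ∣ m] μ(n₁ ⋯ nᵣ) = (1 - r)^ω(m).
-- For an induction on r one inserts a fixed factor e: the sum of μ(n₁ ⋯ nᵣ e) over the tuples with
-- n₁ ⋯ nᵣ e ∣ m is [e ∣ m] μ(e) (1 - r)^k, where k is the number of primes dividing m but not e.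
-- Adding one variable to the tuple amounts to ∑ₙ (-1)^ω(n) c^(k - ω(n)) = (c - 1)^k, the sum being
-- over the products n of distinct primes among these k.
module Submission where

open import Defs
open import Axiom.ExcludedMiddle using (ExcludedMiddle)
open import Data.Empty using (⊥-elim)
open import Data.Integer as ℤ using (ℤ; +_; -[1+_]; 0ℤ; 1ℤ; -1ℤ)
import Data.Integer.Properties as ℤ
open import Data.Integer.Tactic.RingSolver using (solve-∀)
open import Data.List using (List; []; _∷_; _++_; map; foldr; filter; length; upTo; cartesianProductWith)
import Data.List.Properties as List
open import Data.List.Membership.Propositional using (_∈_)
open import Data.List.Membership.Propositional.Properties
  using (∈-filter⁺; ∈-filter⁻; ∈-map⁺; ∈-map⁻; ∈-++⁺ˡ; ∈-++⁺ʳ; ∈-++⁻; ∈-upTo⁺; ∈-upTo⁻)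
open import Data.List.Membership.Propositional.Properties.WithK using (unique∧set⇒bag)
open import Data.List.Relation.Binary.BagAndSetEquality using (∼bag⇒↭)
open import Data.List.Relation.Binary.Permutation.Propositional using (_↭_; ↭⇒↭ₛ)
open import Data.List.Relation.Binary.Permutation.Propositional.Properties using (↭-length; map⁺)
open import Data.List.Relation.Binary.Permutation.Setoid.Properties using (foldr-commMonoid)
open import Data.List.Relation.Unary.All as All using (All; []; _∷_)
open import Data.List.Relation.Unary.All.Properties using (¬Any⇒All¬; All¬⇒¬Any)
open import Data.List.Relation.Unary.AllPairs using ([]; _∷_)
open import Data.List.Relation.Unary.Any using (here; there)
open import Data.List.Relation.Unary.Unique.Propositional using (Unique)
import Data.List.Relation.Unary.Unique.Propositional.Properties as Unique
open import Data.Nat as ℕ using (ℕ; zero; suc; NonZero)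
open import Data.Nat.Divisibility
  using (_∣_; _∣?_; divides; ∣⇒≤; ∣-trans; 1∣_; ∣1⇒≡1; m∣m*n; n∣m*n; ∣n⇒∣m*n; *-cancelˡ-∣; *-cancelʳ-∣; *-monoʳ-∣; *-pres-∣)
open import Data.Nat.Primality
  using (Prime; prime?; prime⇒nonZero; prime⇒irreducible; ¬prime[1]; euclidsLemma)
open import Data.Nat.Primality.Factorisation using (factorise)
import Data.Nat.Properties as ℕ
open import Data.Product using (_×_; _,_; proj₁; proj₂)
open import Data.Rational as ℚ using (ℚ; _/_)
import Data.Rational.Properties as ℚ
open import Data.Sum using (inj₁; inj₂; [_,_]′)
open import Data.Vec using (_∷_)
open import Function using (_∘_; _⇔_; mk⇔; Equivalence)
open import Level using (0ℓ)
open import Relation.Binary.PropositionalEquality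
  using (_≡_; refl; sym; trans; cong; cong₂; subst; subst₂; setoid; module ≡-Reasoning)
open import Relation.Nullary using (¬_; Dec; yes; no; ¬?; contradiction)
open import Relation.Nullary.Decidable using (_×-dec_)
open import Relation.Unary using (Decidable)

open Equivalence using (to; from)
open ≡-Reasoning

-- Finite sums over lists.

-- Counts and changes of the summation range are reduced to this: lists related by a permutation
-- have equal lengths and equal sums.
unique∧set⇒↭ : {A : Set} {xs ys : List A} → Unique xs → Unique ys →
               (∀ {z} → z ∈ xs → z ∈ ys) → (∀ {z} → z ∈ ys → z ∈ xs) → xs ↭ ys
unique∧set⇒↭ u v f g = ∼bag⇒↭ (unique∧set⇒bag u v (mk⇔ f g))

∑-cong : {A : Set} (xs : List A) {f g : A → ℤ} → (∀ a → f a ≡ g a) → ∑ xs f ≡ ∑ xs g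
∑-cong xs eq = cong (foldr ℤ._+_ 0ℤ) (List.map-cong eq xs)

∑-cong-∈ : {A : Set} (xs : List A) {f g : A → ℤ} → (∀ {a} → a ∈ xs → f a ≡ g a) → ∑ xs f ≡ ∑ xs g
∑-cong-∈ xs eq = cong (foldr ℤ._+_ 0ℤ) (List.map-cong-local (All.tabulate eq))

∑-↭ : {A : Set} {xs ys : List A} (f : A → ℤ) → xs ↭ ys → ∑ xs f ≡ ∑ ys f
∑-↭ f xs↭ys = foldr-commMonoid (setoid ℤ) ℤ.+-0-isCommutativeMonoid (↭⇒↭ₛ (map⁺ f xs↭ys))

∑-++ : {A : Set} (xs ys : List A) (f : A → ℤ) → ∑ (xs ++ ys) f ≡ ∑ xs f ℤ.+ ∑ ys f
∑-++ []       ys f = sym (ℤ.+-identityˡ _)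
∑-++ (x ∷ xs) ys f = trans (cong (ℤ._+_ (f x)) (∑-++ xs ys f)) (sym (ℤ.+-assoc (f x) _ _))

∑-map : {A B : Set} (h : A → B) (xs : List A) (f : B → ℤ) → ∑ (map h xs) f ≡ ∑ xs (f ∘ h)
∑-map h xs f = cong (foldr ℤ._+_ 0ℤ) (sym (List.map-∘ xs))

∑-zero : {A : Set} (xs : List A) → ∑ xs (λ _ → 0ℤ) ≡ 0ℤ
∑-zero []       = refl
∑-zero (_ ∷ xs) = trans (ℤ.+-identityˡ _) (∑-zero xs)

∑-const : {A : Set} (xs : List A) (c : ℤ) → ∑ xs (λ _ → c) ≡ c ℤ.* + length xs
∑-const []       c = sym (ℤ.*-zeroʳ c)
∑-const (_ ∷ xs) c = trans (cong (ℤ._+_ c) (∑-const xs c)) (sym (ℤ.*-suc c (+ length xs)))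

∑-+ : {A : Set} (xs : List A) (f g : A → ℤ) → ∑ xs (λ a → f a ℤ.+ g a) ≡ ∑ xs f ℤ.+ ∑ xs g
∑-+ []       f g = refl
∑-+ (x ∷ xs) f g = trans (cong (ℤ._+_ (f x ℤ.+ g x)) (∑-+ xs f g)) (interchange (f x) (g x) _ _)
  where
  interchange : ∀ a b c d → (a ℤ.+ b) ℤ.+ (c ℤ.+ d) ≡ (a ℤ.+ c) ℤ.+ (b ℤ.+ d)
  interchange = solve-∀

∑-swap : {A B : Set} (xs : List A) (ys : List B) (f : A → B → ℤ) →
         ∑ xs (λ a → ∑ ys (f a)) ≡ ∑ ys (λ b → ∑ xs (λ a → f a b))
∑-swap []       ys f = sym (∑-zero ys)
∑-swap (x ∷ xs) ys f = trans (cong (ℤ._+_ (∑ ys (f x))) (∑-swap xs ys f)) (sym (∑-+ ys (f x) _))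

∑-filter : {A : Set} {P : A → Set} (P? : Decidable P) (xs : List A) {f : A → ℤ} →
           (∀ {a} → ¬ P a → f a ≡ 0ℤ) → ∑ (filter P? xs) f ≡ ∑ xs f
∑-filter P? []       f≡0 = refl
∑-filter P? (x ∷ xs) {f} f≡0 with P? x
... | yes _  = cong (ℤ._+_ (f x)) (∑-filter P? xs f≡0)
... | no  ¬p = trans (∑-filter P? xs f≡0)
                 (sym (trans (cong (ℤ._+ ∑ xs f) (f≡0 ¬p)) (ℤ.+-identityˡ _)))

∑-cartesianProductWith : {A B C : Set} (h : A → B → C) (xs : List A) (ys : List B) (f : C → ℤ) →
  ∑ (cartesianProductWith h xs ys) f ≡ ∑ xs (λ a → ∑ ys (λ b → f (h a b)))
∑-cartesianProductWith h []       ys f = refl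
∑-cartesianProductWith h (x ∷ xs) ys f =
  trans (∑-++ (map (h x) ys) _ f)
        (cong₂ ℤ._+_ (∑-map (h x) ys f) (∑-cartesianProductWith h xs ys f))

-- Arithmetic of positive integers.

value-injective : ∀ {m n} → value m ≡ value n → m ≡ n
value-injective {mkℕ⁺ (suc _)} {mkℕ⁺ (suc _)} refl = refl

value-≢0 : ∀ n → NonZero (value n)
value-≢0 (mkℕ⁺ (suc _)) = _

*⁺-assoc : ∀ k m n → (k *⁺ m) *⁺ n ≡ k *⁺ (m *⁺ n)
*⁺-assoc k m n = value-injective (ℕ.*-assoc (value k) (value m) (value n))

*⁺-comm : ∀ m n → m *⁺ n ≡ n *⁺ m
*⁺-comm m n = value-injective (ℕ.*-comm (value m) (value n))

*⁺-identityˡ : ∀ n → 1⁺ *⁺ n ≡ n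
*⁺-identityˡ n = value-injective (ℕ.*-identityˡ (value n))

*⁺-identityʳ : ∀ n → n *⁺ 1⁺ ≡ n
*⁺-identityʳ n = value-injective (ℕ.*-identityʳ (value n))

*⁺-cancelˡ : ∀ k {m n} → k *⁺ m ≡ k *⁺ n → m ≡ n
*⁺-cancelˡ k@(mkℕ⁺ (suc _)) {m} {n} eq =
  value-injective (ℕ.*-cancelˡ-≡ (value m) (value n) (value k) (cong value eq))

-- Prime divisors and `ω`.

prime∣prime⇒≡ : ∀ {p q} → Prime p → Prime q → p ∣ q → p ≡ q
prime∣prime⇒≡ pp pq p∣q with prime⇒irreducible pq p∣q
... | inj₁ refl = contradiction pp ¬prime[1]
... | inj₂ eq   = eq

no-prime-divisor⇒≡1 : ∀ n .{{_ : NonZero n}} → (∀ {p} → Prime p → ¬ p ∣ n) → n ≡ 1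
no-prime-divisor⇒≡1 n none with factorise n
... | record { factors = [] ;    isFactorisation = eq } = eq
... | record { factors = p ∷ ps ; isFactorisation = eq ; factorsPrime = pp ∷ _ } =
  contradiction (subst (p ∣_) (sym eq) (m∣m*n _)) (none pp)

fromPrime : ∀ {p} → Prime p → ℕ⁺
fromPrime {p} pp = mkℕ⁺ p ⦃ prime⇒nonZero pp ⦄

primeDivisor? : ∀ n p → Dec (Prime p × p ∣ value n)
primeDivisor? n p = prime? p ×-dec p ∣? value n

-- By definition `ω n` is the length of this list, so identities for `ω` become permutations of
-- lists.
primeDivisors : ℕ⁺ → List ℕ
primeDivisors n = filter (primeDivisor? n) (upTo (suc (value n)))

∈-primeDivisors⁺ : ∀ n {p} → Prime p → p ∣ value n → p ∈ primeDivisors n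
∈-primeDivisors⁺ n pp p∣n =
  ∈-filter⁺ (primeDivisor? n) (∈-upTo⁺ (ℕ.s≤s (∣⇒≤ {{value-≢0 n}} p∣n))) (pp , p∣n)

∈-primeDivisors⁻ : ∀ n {p} → p ∈ primeDivisors n → Prime p × p ∣ value n
∈-primeDivisors⁻ n p∈ = proj₂ (∈-filter⁻ (primeDivisor? n) {xs = upTo (suc (value n))} p∈)

primeDivisors-unique : ∀ n → Unique (primeDivisors n)
primeDivisors-unique n = Unique.filter⁺ (primeDivisor? n) (Unique.upTo⁺ (suc (value n)))

-- By Euclid's lemma the primes dividing `p n` are `p` and those dividing `n`; since `p` does not
-- divide `n`, it is new.
ω-prime-* : ∀ {p} (pp : Prime p) n → ¬ p ∣ value n → ω (fromPrime pp *⁺ n) ≡ suc (ω n)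
ω-prime-* {p} pp n p∤n = ↭-length (unique∧set⇒↭
  (primeDivisors-unique pn)
  (¬Any⇒All¬ _ (p∤n ∘ proj₂ ∘ ∈-primeDivisors⁻ n) ∷ primeDivisors-unique n)
  into onto)
  where
  pn = fromPrime pp *⁺ n
  into : ∀ {q} → q ∈ primeDivisors pn → q ∈ p ∷ primeDivisors n
  into q∈ with ∈-primeDivisors⁻ pn q∈
  ... | pq , q∣pn with euclidsLemma p (value n) pq q∣pn
  ...   | inj₁ q∣p = here (prime∣prime⇒≡ pq pp q∣p)
  ...   | inj₂ q∣n = there (∈-primeDivisors⁺ n pq q∣n)
  onto : ∀ {q} → q ∈ p ∷ primeDivisors n → q ∈ primeDivisors pn
  onto (here refl) = ∈-primeDivisors⁺ pn pp (m∣m*n (value n))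
  onto (there q∈)  = let pq , q∣n = ∈-primeDivisors⁻ n q∈ in
                     ∈-primeDivisors⁺ pn pq (∣n⇒∣m*n p q∣n)

-- These are the primes that can still be multiplied onto a squarefree divisor `e` of `m` to give
-- another one. The length is the exponent k in the overview.
primesAvoiding : ℕ⁺ → ℕ⁺ → List ℕ
primesAvoiding m e = filter (λ p → ¬? (p ∣? value e)) (primeDivisors m)

∈-primesAvoiding⁺ : ∀ m e {p} → Prime p → p ∣ value m → ¬ p ∣ value e → p ∈ primesAvoiding m e
∈-primesAvoiding⁺ m e pp p∣m p∤e = ∈-filter⁺ (λ p → ¬? (p ∣? value e)) (∈-primeDivisors⁺ m pp p∣m) p∤e

∈-primesAvoiding⁻ : ∀ m e {p} → p ∈ primesAvoiding m e → (Prime p × p ∣ value m) × ¬ p ∣ value e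
∈-primesAvoiding⁻ m e p∈ =
  let p∈m , p∤e = ∈-filter⁻ (λ p → ¬? (p ∣? value e)) {xs = primeDivisors m} p∈
  in ∈-primeDivisors⁻ m p∈m , p∤e

primesAvoiding-unique : ∀ m e → Unique (primesAvoiding m e)
primesAvoiding-unique m e = Unique.filter⁺ (λ p → ¬? (p ∣? value e)) (primeDivisors-unique m)

length-primesAvoiding-1 : ∀ m → length (primesAvoiding m 1⁺) ≡ ω m
length-primesAvoiding-1 m = cong length (List.filter-all (λ p → ¬? (p ∣? 1))
  (All.tabulate λ p∈ p∣1 →
    ¬prime[1] (subst Prime (∣1⇒≡1 p∣1) (proj₁ (∈-primeDivisors⁻ m p∈)))))

-- Moving `p` into `e` takes `p` and no other prime off the list. This tracks the exponent of `c` in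
-- `weight`.
length-primesAvoiding-* : ∀ m e {p} (pp : Prime p) → p ∣ value m → ¬ p ∣ value e →
  length (primesAvoiding m e) ≡ suc (length (primesAvoiding m (fromPrime pp *⁺ e)))
length-primesAvoiding-* m e {p} pp p∣m p∤e = ↭-length (unique∧set⇒↭
  (primesAvoiding-unique m e)
  (¬Any⇒All¬ _ (λ p∈ → proj₂ (∈-primesAvoiding⁻ m pe p∈) (m∣m*n (value e))) ∷ primesAvoiding-unique m pe)
  into onto)
  where
  pe = fromPrime pp *⁺ e
  into : ∀ {q} → q ∈ primesAvoiding m e → q ∈ p ∷ primesAvoiding m pe
  into {q} q∈ with ∈-primesAvoiding⁻ m e q∈ | q ℕ.≟ p
  ... | _                | yes q≡p = here q≡p
  ... | (pq , q∣m) , q∤e | no  q≢p = there (∈-primesAvoiding⁺ m pe pq q∣m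
          ([ q≢p ∘ prime∣prime⇒≡ pq pp , q∤e ]′ ∘ euclidsLemma p (value e) pq))
  onto : ∀ {q} → q ∈ p ∷ primesAvoiding m pe → q ∈ primesAvoiding m e
  onto (here refl) = ∈-primesAvoiding⁺ m e pp p∣m p∤e
  onto (there q∈)  = let (pq , q∣m) , q∤pe = ∈-primesAvoiding⁻ m pe q∈ in
                     ∈-primesAvoiding⁺ m e pq q∣m (q∤pe ∘ ∣n⇒∣m*n p)

-- Squarefree divisors.

SquareFreeDivisor : ℕ⁺ → ℕ⁺ → Set
SquareFreeDivisor m n = SquareFree n × value n ∣ value m

squareFreeDivisor? : ∀ m n → Dec (SquareFreeDivisor m n)
squareFreeDivisor? m n = squareFree? n ×-dec value n ∣? value m

-- Let `q q` divide `p n`. If `q ≡ p`, cancelling leaves `p ∣ n`. Otherwise Euclid's lemma, applied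
-- twice, passes both factors `q` to `n`.
squareFree-* : ∀ {p} (pp : Prime p) n → ¬ p ∣ value n → SquareFree n → SquareFree (fromPrime pp *⁺ n)
squareFree-* {p} pp n p∤n sf {q} pq qq∣pn with q ℕ.≟ p
... | yes refl = p∤n (*-cancelˡ-∣ p {{prime⇒nonZero pp}} qq∣pn)
... | no  q≢p with euclidsLemma p (value n) pq (∣-trans (m∣m*n q) qq∣pn)
...   | inj₁ q∣p = q≢p (prime∣prime⇒≡ pq pp q∣p)
...   | inj₂ (divides k n≡kq)
  with euclidsLemma p k pq (*-cancelʳ-∣ q {{prime⇒nonZero pq}}
         (subst (q ℕ.* q ∣_) (trans (cong (p ℕ.*_) n≡kq) (sym (ℕ.*-assoc p k q))) qq∣pn))
...     | inj₁ q∣p            = q≢p (prime∣prime⇒≡ pq pp q∣p)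
...     | inj₂ (divides j k≡jq) = sf pq (divides j
          (trans n≡kq (trans (cong (ℕ._* q) k≡jq) (ℕ.*-assoc j q q))))

-- Since `p` divides `m ≡ k n` but not `n`, it divides the cofactor `k`, which leaves room for `p n`
-- in `m`.
squareFreeDivisor-* : ∀ m {p} (pp : Prime p) n → p ∣ value m → ¬ p ∣ value n →
  SquareFreeDivisor m n → SquareFreeDivisor m (fromPrime pp *⁺ n)
squareFreeDivisor-* m {p} pp n p∣m p∤n (sf , divides k m≡kn)
  with euclidsLemma k (value n) pp (subst (p ∣_) m≡kn p∣m)
... | inj₂ p∣n = contradiction p∣n p∤n
... | inj₁ (divides j k≡jp) = squareFree-* pp n p∤n sf , divides j
        (trans m≡kn (trans (cong (ℕ._* value n) k≡jp) (ℕ.*-assoc j p (value n))))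

squareFree-∣ : ∀ m n → SquareFree n → value m ∣ value n → SquareFree m
squareFree-∣ m n sf m∣n pp pp∣m = sf pp (∣-trans pp∣m m∣n)

squareFreeDivisor-*ʳ : ∀ m n e → SquareFreeDivisor m (n *⁺ e) → SquareFreeDivisor m e
squareFreeDivisor-*ʳ m n e (sf , d) =
  squareFree-∣ e (n *⁺ e) sf (n∣m*n (value n)) , ∣-trans (n∣m*n (value n)) d

-- Products of distinct primes.

-- The products without `p` come first, then those with `p`. The primality proofs are carried along
-- because they make each factor a positive integer.
subproducts : ∀ {ps} → All Prime ps → List ℕ⁺
subproducts []         = 1⁺ ∷ []
subproducts (pp ∷ pps) = subproducts pps ++ map (fromPrime pp *⁺_) (subproducts pps)

prime∣subproduct⇒∈ : ∀ {ps} (pps : All Prime ps) {n q} → n ∈ subproducts pps → Prime q → q ∣ value n → q ∈ ps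
prime∣subproduct⇒∈ [] (here refl) pq q∣1 = contradiction (subst Prime (∣1⇒≡1 q∣1) pq) ¬prime[1]
prime∣subproduct⇒∈ {p ∷ _} (pp ∷ pps) n∈ pq q∣n with ∈-++⁻ (subproducts pps) n∈
... | inj₁ n∈ˡ = there (prime∣subproduct⇒∈ pps n∈ˡ pq q∣n)
... | inj₂ n∈ʳ with ∈-map⁻ (fromPrime pp *⁺_) n∈ʳ
...   | k , k∈ , refl with euclidsLemma p (value k) pq q∣n
...     | inj₁ q∣p = here (prime∣prime⇒≡ pq pp q∣p)
...     | inj₂ q∣k = there (prime∣subproduct⇒∈ pps k∈ pq q∣k)

-- The two halves are disjoint: `p` divides each product in the second, but a prime dividing one in
-- the first lies in the tail, where `p` does not occur.
subproducts-unique : ∀ {ps} (pps : All Prime ps) → Unique ps → Unique (subproducts pps)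
subproducts-unique []         _        = [] ∷ []
subproducts-unique (pp ∷ pps) (p∉ ∷ u) = Unique.++⁺ (subproducts-unique pps u)
  (Unique.map⁺ (*⁺-cancelˡ (fromPrime pp)) (subproducts-unique pps u))
  λ (n∈ˡ , n∈ʳ) → let k , _ , n≡pk = ∈-map⁻ (fromPrime pp *⁺_) n∈ʳ in
    All¬⇒¬Any p∉ (prime∣subproduct⇒∈ pps n∈ˡ pp
      (subst (λ n → _ ∣ value n) (sym n≡pk) (m∣m*n (value k))))

-- Split on whether `p` divides `n`. If it does, squarefreeness keeps `p` from dividing the cofactor
-- `k`, so the primes of `k` lie in the tail.
squareFree⇒∈-subproducts : ∀ {ps} (pps : All Prime ps) n → SquareFree n →
  (∀ {q} → Prime q → q ∣ value n → q ∈ ps) → n ∈ subproducts pps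
squareFree⇒∈-subproducts [] n sf supp =
  here (value-injective (no-prime-divisor⇒≡1 (value n) {{value-≢0 n}} λ pq q∣n → contradiction (supp pq q∣n) λ ()))
squareFree⇒∈-subproducts {p ∷ ps} (pp ∷ pps) n sf supp with p ∣? value n
... | no p∤n = ∈-++⁺ˡ (squareFree⇒∈-subproducts pps n sf λ pq q∣n → tail pq q∣n (supp pq q∣n))
  where
  tail : ∀ {q} → Prime q → q ∣ value n → q ∈ p ∷ ps → q ∈ ps
  tail pq q∣n (here refl) = contradiction q∣n p∤n
  tail pq q∣n (there q∈)  = q∈
... | yes (divides zero n≡0) = contradiction n≡0 (ℕ.≢-nonZero⁻¹ (value n) {{value-≢0 n}})
... | yes (divides (suc k) n≡kp) = ∈-++⁺ʳ (subproducts pps)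
  (subst (_∈ map (fromPrime pp *⁺_) (subproducts pps)) (sym n≡pk)
    (∈-map⁺ (fromPrime pp *⁺_)
      (squareFree⇒∈-subproducts pps k⁺ (squareFree-∣ k⁺ n sf k∣n)
        λ pq q∣k → tail q∣k (supp pq (∣-trans q∣k k∣n)))))
  where
  k⁺ = mkℕ⁺ (suc k)
  k∣n : suc k ∣ value n
  k∣n = subst (suc k ∣_) (sym n≡kp) (m∣m*n p)
  n≡pk : n ≡ fromPrime pp *⁺ k⁺
  n≡pk = value-injective (trans n≡kp (ℕ.*-comm (suc k) p))
  p∤k : ¬ p ∣ suc k
  p∤k p∣k = sf pp (subst (p ℕ.* p ∣_) (sym (cong value n≡pk)) (*-monoʳ-∣ p p∣k))
  tail : ∀ {q} → q ∣ suc k → q ∈ p ∷ ps → q ∈ ps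
  tail q∣k (here refl) = contradiction q∣k p∤k
  tail q∣k (there q∈)  = q∈

-- e varies in the induction: the subproducts divisible by p are treated by moving p into e.
AdmissiblePrimes : ℕ⁺ → ℕ⁺ → List ℕ → Set
AdmissiblePrimes m e ps = Unique ps × All (λ p → p ∣ value m × ¬ p ∣ value e) ps

-- The two conclusions serve the two halves of `subproducts`: `e` stays when `p` is left out and
-- becomes `p e` when `p` is used. In the second case no later prime divides `p`, as the list has no
-- repetition.
admissiblePrimes-tail : ∀ m e {p ps} (pp : Prime p) → All Prime ps → AdmissiblePrimes m e (p ∷ ps) →
  AdmissiblePrimes m e ps × AdmissiblePrimes m (fromPrime pp *⁺ e) ps
admissiblePrimes-tail m e {p} {ps} pp pps (p∉ ∷ u , _ ∷ adm) = (u , adm) , (u , All.tabulate step)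
  where
  step : ∀ {q} → q ∈ ps → q ∣ value m × ¬ q ∣ p ℕ.* value e
  step q∈ = let q∣m , q∤e = All.lookup adm q∈ ; pq = All.lookup pps q∈ in q∣m ,
    [ (λ q∣p → All.lookup p∉ q∈ (sym (prime∣prime⇒≡ pq pp q∣p))) , q∤e ]′ ∘ euclidsLemma p (value e) pq

*⁺-swap : ∀ k m n → (k *⁺ m) *⁺ n ≡ m *⁺ (k *⁺ n)
*⁺-swap k m n = trans (cong (_*⁺ n) (*⁺-comm k m)) (*⁺-assoc m k n)

∈-subproducts⇒squareFreeDivisor : ∀ m e {ps} (pps : All Prime ps) → AdmissiblePrimes m e ps →
  SquareFreeDivisor m e → ∀ {n} → n ∈ subproducts pps → SquareFreeDivisor m (n *⁺ e)
∈-subproducts⇒squareFreeDivisor m e [] adm sfd (here refl) = subst (SquareFreeDivisor m) (sym (*⁺-identityˡ e)) sfd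
∈-subproducts⇒squareFreeDivisor m e (pp ∷ pps) adm@(_ , (p∣m , p∤e) ∷ _) sfd n∈
  with ∈-++⁻ (subproducts pps) n∈ | admissiblePrimes-tail m e pp pps adm
... | inj₁ n∈ˡ | adm-e , _ = ∈-subproducts⇒squareFreeDivisor m e pps adm-e sfd n∈ˡ
... | inj₂ n∈ʳ | _ , adm-pe with ∈-map⁻ (fromPrime pp *⁺_) n∈ʳ
...   | k , k∈ , refl = subst (SquareFreeDivisor m) (sym (*⁺-swap (fromPrime pp) k e))
        (∈-subproducts⇒squareFreeDivisor m (fromPrime pp *⁺ e) pps adm-pe
          (squareFreeDivisor-* m pp e p∣m p∤e sfd) k∈)

-- The Möbius function restricted to divisors.

-- The condition `n ∣ m` sits in the summand, so that sums over divisors or multiples can run over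
-- one fixed list and be exchanged.
μ∣ : ℕ⁺ → ℕ⁺ → ℤ
μ∣ m n with value n ∣? value m
... | yes _ = μ n
... | no  _ = 0ℤ

μ∣-∣ : ∀ m n → value n ∣ value m → μ∣ m n ≡ μ n
μ∣-∣ m n n∣m with value n ∣? value m
... | yes _   = refl
... | no  n∤m = contradiction n∣m n∤m

μ∣-∤ : ∀ m n → ¬ value n ∣ value m → μ∣ m n ≡ 0ℤ
μ∣-∤ m n n∤m with value n ∣? value m
... | yes n∣m = contradiction n∣m n∤m
... | no  _   = refl

μ-squareFree : ∀ n → SquareFree n → μ n ≡ -1ℤ ℤ.^ ω n
μ-squareFree n sf with squareFree? n
... | yes _   = refl
... | no  ¬sf = contradiction (λ {p} → sf {p}) ¬sf

μ-¬squareFree : ∀ n → ¬ SquareFree n → μ n ≡ 0ℤ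
μ-¬squareFree n ¬sf with squareFree? n
... | yes sf = contradiction (λ {p} → sf {p}) ¬sf
... | no  _  = refl

μ∣-squareFreeDivisor : ∀ m n → SquareFreeDivisor m n → μ∣ m n ≡ -1ℤ ℤ.^ ω n
μ∣-squareFreeDivisor m n (sf , n∣m) = trans (μ∣-∣ m n n∣m) (μ-squareFree n sf)

μ∣-¬squareFreeDivisor : ∀ m n → ¬ SquareFreeDivisor m n → μ∣ m n ≡ 0ℤ
μ∣-¬squareFreeDivisor m n ¬sfd with value n ∣? value m
... | yes n∣m = μ-¬squareFree n (λ sf → ¬sfd (sf , n∣m))
... | no  _   = refl

μ∣-prime-* : ∀ m n {p} (pp : Prime p) → p ∣ value m → ¬ p ∣ value n → SquareFreeDivisor m n →
             μ∣ m (fromPrime pp *⁺ n) ≡ ℤ.- μ∣ m n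
μ∣-prime-* m n pp p∣m p∤n sfd = begin
  μ∣ m (fromPrime pp *⁺ n)        ≡⟨ μ∣-squareFreeDivisor m _ (squareFreeDivisor-* m pp n p∣m p∤n sfd) ⟩
  -1ℤ ℤ.^ ω (fromPrime pp *⁺ n)   ≡⟨ cong (-1ℤ ℤ.^_) (ω-prime-* pp n p∤n) ⟩
  -1ℤ ℤ.* -1ℤ ℤ.^ ω n             ≡⟨ ℤ.-1*i≡-i (-1ℤ ℤ.^ ω n) ⟩
  ℤ.- (-1ℤ ℤ.^ ω n)               ≡⟨ cong ℤ.-_ (sym (μ∣-squareFreeDivisor m n sfd)) ⟩
  ℤ.- μ∣ m n                      ∎

-- Sums over one variable and over tuples.

-- For `c = 1 - r` this is the value of the sum over `r`-tuples with fixed factor `e`. At `r = 1`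
-- the base is 0, and the convention `0 ^ 0 = 1` matters.
weight : ℤ → ℕ⁺ → ℕ⁺ → ℤ
weight c m e = μ∣ m e ℤ.* c ℤ.^ length (primesAvoiding m e)

weight-¬squareFreeDivisor : ∀ c m e → ¬ SquareFreeDivisor m e → weight c m e ≡ 0ℤ
weight-¬squareFreeDivisor c m e ¬sfd =
  trans (cong (ℤ._* c ℤ.^ length (primesAvoiding m e)) (μ∣-¬squareFreeDivisor m e ¬sfd)) (ℤ.*-zeroˡ (c ℤ.^ length (primesAvoiding m e)))

-- Each prime of `ps` contributes a factor `c - 1`: it gives `c` when left out of `n`, as it still
-- avoids `n e`, and `-1` when included, from the sign of `μ`. The number `j` counts the primes
-- avoiding `e` outside `ps`; each of them keeps its factor `c`.
∑-weight-subproducts : ∀ c m e {ps} (pps : All Prime ps) → AdmissiblePrimes m e ps → SquareFreeDivisor m e →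
  ∀ j → length (primesAvoiding m e) ≡ length ps ℕ.+ j →
  ∑ (subproducts pps) (λ n → weight c m (n *⁺ e)) ≡ μ∣ m e ℤ.* ((c ℤ.- 1ℤ) ℤ.^ length ps ℤ.* c ℤ.^ j)
∑-weight-subproducts c m e [] adm sfd j len = begin
  weight c m (1⁺ *⁺ e) ℤ.+ 0ℤ     ≡⟨ ℤ.+-identityʳ _ ⟩
  weight c m (1⁺ *⁺ e)            ≡⟨ cong (weight c m) (*⁺-identityˡ e) ⟩
  weight c m e                    ≡⟨ cong (λ k → μ∣ m e ℤ.* c ℤ.^ k) len ⟩
  μ∣ m e ℤ.* c ℤ.^ j              ≡⟨ cong (μ∣ m e ℤ.*_) (sym (ℤ.*-identityˡ (c ℤ.^ j))) ⟩
  μ∣ m e ℤ.* (1ℤ ℤ.* c ℤ.^ j)     ∎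
∑-weight-subproducts c m e {p ∷ ps} (pp ∷ pps) adm@(_ , (p∣m , p∤e) ∷ _) sfd j len = begin
  ∑ (D ++ map (p⁺ *⁺_) D) f
    ≡⟨ ∑-++ D _ f ⟩
  ∑ D f ℤ.+ ∑ (map (p⁺ *⁺_) D) f
    ≡⟨ cong (ℤ._+_ (∑ D f)) (trans (∑-map (p⁺ *⁺_) D f) (∑-cong D λ n → cong (weight c m) (*⁺-swap p⁺ n e))) ⟩
  ∑ D f ℤ.+ ∑ D (λ n → weight c m (n *⁺ (p⁺ *⁺ e)))
    -- Left out, `p` joins the `j` remaining primes, hence `suc j`; included, it moves into `e` and
    -- `j` is unchanged.
    ≡⟨ cong₂ ℤ._+_
         (∑-weight-subproducts c m e pps adm-e sfd (suc j) (trans len (sym (ℕ.+-suc (length ps) j))))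
         (∑-weight-subproducts c m (p⁺ *⁺ e) pps adm-pe (squareFreeDivisor-* m pp e p∣m p∤e sfd) j
           (ℕ.suc-injective (trans (sym (length-primesAvoiding-* m e pp p∣m p∤e)) len))) ⟩
  μ∣ m e ℤ.* (b ℤ.* (c ℤ.* c ℤ.^ j)) ℤ.+ μ∣ m (p⁺ *⁺ e) ℤ.* (b ℤ.* c ℤ.^ j)
    ≡⟨ cong (λ z → μ∣ m e ℤ.* (b ℤ.* (c ℤ.* c ℤ.^ j)) ℤ.+ z ℤ.* (b ℤ.* c ℤ.^ j))
         (μ∣-prime-* m e pp p∣m p∤e sfd) ⟩
  μ∣ m e ℤ.* (b ℤ.* (c ℤ.* c ℤ.^ j)) ℤ.+ ℤ.- μ∣ m e ℤ.* (b ℤ.* c ℤ.^ j)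
    ≡⟨ factor (μ∣ m e) b c (c ℤ.^ j) ⟩
  μ∣ m e ℤ.* ((c ℤ.- 1ℤ) ℤ.* b ℤ.* c ℤ.^ j)
    ∎
  where
  D  = subproducts pps
  p⁺ = fromPrime pp
  b  = (c ℤ.- 1ℤ) ℤ.^ length ps
  f : ℕ⁺ → ℤ
  f n = weight c m (n *⁺ e)
  adm-e  = proj₁ (admissiblePrimes-tail m e pp pps adm)
  adm-pe = proj₂ (admissiblePrimes-tail m e pp pps adm)
  factor : ∀ u b c y → u ℤ.* (b ℤ.* (c ℤ.* y)) ℤ.+ ℤ.- u ℤ.* (b ℤ.* y) ≡ u ℤ.* ((c ℤ.- 1ℤ) ℤ.* b ℤ.* y)
  factor = solve-∀

-- Together with `Unique`, this is all that the sums over divisors of `m` require of the summation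
-- range.
DivisorClosed : ℕ⁺ → List ℕ⁺ → Set
DivisorClosed m L = ∀ n → value n ∣ value m → n ∈ L

-- This is the step from `r` to `r + 1` variables. Only those `n` contribute for which `n e` is a
-- squarefree divisor of `m`, and they are the products of distinct primes from
-- `primesAvoiding m e`.
∑-weight : ∀ c m L → Unique L → DivisorClosed m L → ∀ e →
           ∑ L (λ n → weight c m (n *⁺ e)) ≡ weight (c ℤ.- 1ℤ) m e
∑-weight c m L uL closed e with squareFreeDivisor? m e
-- If `e` is not a squarefree divisor, neither is any `n e`, and both sides vanish.
... | no ¬sfd = trans
  (∑-cong L λ n → weight-¬squareFreeDivisor c m (n *⁺ e) (¬sfd ∘ squareFreeDivisor-*ʳ m n e))
  (trans (∑-zero L) (sym (weight-¬squareFreeDivisor (c ℤ.- 1ℤ) m e ¬sfd)))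
... | yes sfd@(sf , e∣m) = begin
  ∑ L f               ≡⟨ sym (∑-filter P? L (weight-¬squareFreeDivisor c m _)) ⟩
  ∑ (filter P? L) f   ≡⟨ ∑-↭ f (unique∧set⇒↭ (Unique.filter⁺ P? uL) (subproducts-unique pps uQ) into onto) ⟩
  ∑ (subproducts pps) f
    -- All primes avoiding `e` are in the list, so none remain and `j` is 0.
    ≡⟨ ∑-weight-subproducts c m e pps adm sfd 0 (sym (ℕ.+-identityʳ _)) ⟩
  μ∣ m e ℤ.* ((c ℤ.- 1ℤ) ℤ.^ length Q ℤ.* 1ℤ)
    ≡⟨ cong (μ∣ m e ℤ.*_) (ℤ.*-identityʳ _) ⟩
  weight (c ℤ.- 1ℤ) m e ∎
  where
  Q  = primesAvoiding m e
  uQ = primesAvoiding-unique m e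
  f : ℕ⁺ → ℤ
  f n = weight c m (n *⁺ e)
  P? : ∀ n → Dec (SquareFreeDivisor m (n *⁺ e))
  P? n = squareFreeDivisor? m (n *⁺ e)
  pps : All Prime Q
  pps = All.tabulate (proj₁ ∘ proj₁ ∘ ∈-primesAvoiding⁻ m e)
  adm : AdmissiblePrimes m e Q
  adm = uQ , All.tabulate λ q∈ → let (_ , q∣m) , q∤e = ∈-primesAvoiding⁻ m e q∈ in q∣m , q∤e
  into : ∀ {n} → n ∈ filter P? L → n ∈ subproducts pps
  into {n} n∈ with ∈-filter⁻ P? {xs = L} n∈
  ... | _ , sf-ne , ne∣m = squareFree⇒∈-subproducts pps n
    (squareFree-∣ n (n *⁺ e) sf-ne (m∣m*n (value e)))
    λ {q} pq q∣n → ∈-primesAvoiding⁺ m e pq (∣-trans q∣n (∣-trans (m∣m*n (value e)) ne∣m))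
      -- A prime dividing both `n` and `e` would put its square into `n e`.
      λ q∣e → sf-ne pq (*-pres-∣ q∣n q∣e)
  onto : ∀ {n} → n ∈ subproducts pps → n ∈ filter P? L
  onto {n} n∈ = let sfd-ne = ∈-subproducts⇒squareFreeDivisor m e pps adm sfd n∈ in
    ∈-filter⁺ P? (closed n (∣-trans (m∣m*n (value e)) (proj₂ sfd-ne))) sfd-ne

-- The free factor `e` carries the induction on `r`: the first entry `n` of the tuple moves into it,
-- and `∑-weight` then sums over `n`. The base case has `c = 1`, whose powers are all 1.
∑-tuples-weight : ∀ m L → Unique L → DivisorClosed m L → ∀ r e →
  ∑ (tuples r L) (λ ns → μ∣ m (∏ ns *⁺ e)) ≡ weight (1ℤ ℤ.- + r) m e
∑-tuples-weight m L uL closed zero e = begin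
  μ∣ m (1⁺ *⁺ e) ℤ.+ 0ℤ   ≡⟨ ℤ.+-identityʳ _ ⟩
  μ∣ m (1⁺ *⁺ e)          ≡⟨ cong (μ∣ m) (*⁺-identityˡ e) ⟩
  μ∣ m e                  ≡⟨ sym (ℤ.*-identityʳ _) ⟩
  μ∣ m e ℤ.* 1ℤ           ≡⟨ cong (μ∣ m e ℤ.*_) (sym (ℤ.^-zeroˡ (length (primesAvoiding m e)))) ⟩
  weight 1ℤ m e           ∎
∑-tuples-weight m L uL closed (suc r) e = begin
  ∑ (tuples (suc r) L) (λ ns → μ∣ m (∏ ns *⁺ e))
    ≡⟨ ∑-cartesianProductWith _∷_ L (tuples r L) (λ ns → μ∣ m (∏ ns *⁺ e)) ⟩
  ∑ L (λ n → ∑ (tuples r L) (λ ns → μ∣ m ((n *⁺ ∏ ns) *⁺ e)))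
    ≡⟨ ∑-cong L (λ n → ∑-cong (tuples r L) λ ns → cong (μ∣ m) (*⁺-swap n (∏ ns) e)) ⟩
  ∑ L (λ n → ∑ (tuples r L) (λ ns → μ∣ m (∏ ns *⁺ (n *⁺ e))))
    ≡⟨ ∑-cong L (λ n → ∑-tuples-weight m L uL closed r (n *⁺ e)) ⟩
  ∑ L (λ n → weight (1ℤ ℤ.- + r) m (n *⁺ e))
    ≡⟨ ∑-weight (1ℤ ℤ.- + r) m L uL closed e ⟩
  weight (1ℤ ℤ.- + r ℤ.- 1ℤ) m e
    ≡⟨ cong (λ c → weight c m e) (1-r-1≡1-[1+r] (+ r)) ⟩
  weight (1ℤ ℤ.- + suc r) m e ∎
  where
  1-r-1≡1-[1+r] : ∀ i → 1ℤ ℤ.- i ℤ.- 1ℤ ≡ 1ℤ ℤ.- (1ℤ ℤ.+ i)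
  1-r-1≡1-[1+r] = solve-∀

∑-tuples-μ∣ : ∀ m L → Unique L → DivisorClosed m L → ∀ r →
  ∑ (tuples r L) (μ∣ m ∘ ∏) ≡ (1ℤ ℤ.- + r) ℤ.^ ω m
∑-tuples-μ∣ m L uL closed r = begin
  ∑ (tuples r L) (μ∣ m ∘ ∏)
    ≡⟨ ∑-cong (tuples r L) (λ ns → cong (μ∣ m) (sym (*⁺-identityʳ (∏ ns)))) ⟩
  ∑ (tuples r L) (λ ns → μ∣ m (∏ ns *⁺ 1⁺))
    ≡⟨ ∑-tuples-weight m L uL closed r 1⁺ ⟩
  μ∣ m 1⁺ ℤ.* (1ℤ ℤ.- + r) ℤ.^ length (primesAvoiding m 1⁺)
    -- `μ 1⁺` computes to 1, and every prime divisor of `m` avoids 1.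
    ≡⟨ cong₂ ℤ._*_ (μ∣-∣ m 1⁺ (1∣ value m)) (cong ((1ℤ ℤ.- + r) ℤ.^_) (length-primesAvoiding-1 m)) ⟩
  1ℤ ℤ.* (1ℤ ℤ.- + r) ℤ.^ ω m
    ≡⟨ ℤ.*-identityˡ _ ⟩
  (1ℤ ℤ.- + r) ℤ.^ ω m ∎

-- Comparison of integers with scaled reals.

/1-mono-≤ : ∀ {i j} → i ℤ.≤ j → i / 1 ℚ.≤ j / 1
/1-mono-≤ {i} {j} i≤j = subst₂ ℚ._≤_ (sym (i/1≡ i)) (sym (i/1≡ j))
  (ℚ.*≤* (subst₂ ℤ._≤_ (sym (ℤ.*-identityʳ i)) (sym (ℤ.*-identityʳ j)) i≤j))

/1-* : ∀ m n → (+ m / 1) ℚ.* (+ n / 1) ≡ + (m ℕ.* n) / 1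
/1-* m n = begin
  (+ m / 1) ℚ.* (+ n / 1)   ≡⟨ cong₂ ℚ._*_ (i/1≡ (+ m)) (i/1≡ (+ n)) ⟩
  (+ m ℤ.* + n) / 1         ≡⟨ cong (_/ 1) (sym (ℤ.pos-* m n)) ⟩
  + (m ℕ.* n) / 1           ∎

fromℤ-mono-≤ : ∀ {i j} → i ℤ.≤ j → fromℤ i ≤ fromℤ j
fromℤ-mono-≤ i≤j _ q<i = ℚ.<-≤-trans q<i (/1-mono-≤ i≤j)

≤-trans : ∀ x y z → x ≤ y → y ≤ z → x ≤ z
≤-trans _ _ _ x≤y y≤z q = y≤z q ∘ x≤y q

-- The lower cut of `x ÷ d` is that of `x` pulled back along multiplication by `d`, an
-- order-preserving bijection of the rationals.
fromℕ-≤-÷ : ∀ x d n → fromℕ n ≤ x ÷ d ⇔ fromℕ (n ℕ.* value d) ≤ x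
fromℕ-≤-÷ x d@(mkℕ⁺ k) n = mk⇔
  (λ n≤x÷d q q<nd → subst (ℝ.lower x) (cancel q)
    (n≤x÷d (q ℚ.÷ N) (ℚ.*-cancelʳ-<-nonNeg N
      (subst₂ ℚ._<_ (sym (cancel q)) (sym (/1-* n k)) q<nd))))
  (λ nd≤x q q<n → nd≤x (q ℚ.* N) (subst (q ℚ.* N ℚ.<_) (/1-* n k) (ℚ.*-monoˡ-<-pos N q<n)))
  where
  N : ℚ
  N = + k / 1
  instance
    N-pos : ℚ.Positive N
    N-pos = ℚ.normalize-pos k 1

    N-nonNeg : ℚ.NonNegative N
    N-nonNeg = ℚ.pos⇒nonNeg N

    N-nonZero : ℚ.NonZero N
    N-nonZero = ℚ.pos⇒nonZero N
  cancel : ∀ q → (q ℚ.÷ N) ℚ.* N ≡ q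
  cancel q = trans (ℚ.*-assoc q (ℚ.1/ N) N)
            (trans (cong (q ℚ.*_) (ℚ.*-inverseˡ N)) (ℚ.*-identityʳ q))

-- Integer parts as counts.

module Floor (em : ExcludedMiddle 0ℓ) where
  open Classical em

  -- Once the integer part is known to be some `m ≥ 0`, the positive integers up to `y` are 1, ...,
  -- `m`.
  ⌊⌋≡length-positives≤ : ∀ y → fromℕ 0 ≤ y → ⌊ y ⌋ ≡ + length (positives≤ y)
  ⌊⌋≡length-positives≤ y 0≤y with floor y
  -- A negative integer part, plus one, is at most 0 and hence at most `y`, against the upper bound
  -- on `y`.
  ... | -[1+ k ] , _ , y<m+1 = ⊥-elim (≤-<-absurd (fromℤ (-[1+ k ] ℤ.+ 1ℤ)) y
          (≤-trans (fromℤ (-[1+ k ] ℤ.+ 1ℤ)) (fromℕ 0) y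
            (fromℤ-mono-≤ { -[1+ k ] ℤ.+ 1ℤ} {0ℤ} (ℤ.i<j⇒suc[i]≤j { -[1+ k ]} ℤ.-<+)) 0≤y) y<m+1)
  ... | + m , m≤y , y<m+1 = cong +_ (begin
    m                            ≡⟨ sym (List.length-upTo m) ⟩
    length (upTo m)              ≡⟨ sym (List.length-map _ (upTo m)) ⟩
    length (map suc⁺ (upTo m))   ≡⟨ ↭-length (unique∧set⇒↭
                                      (Unique.map⁺ (ℕ.suc-injective ∘ cong value) (Unique.upTo⁺ m))
                                      (positives≤-unique y) into onto) ⟩
    length (positives≤ y)        ∎)
    where
    suc⁺ : ℕ → ℕ⁺
    suc⁺ k = mkℕ⁺ (suc k)
    into : ∀ {n} → n ∈ map suc⁺ (upTo m) → n ∈ positives≤ y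
    into n∈ with ∈-map⁻ suc⁺ n∈
    ... | k , k∈ , refl = from (∈-positives≤ y (suc⁺ k))
      (≤-trans (fromℕ (suc k)) (fromℕ m) y (fromℤ-mono-≤ (ℤ.+≤+ (∈-upTo⁻ k∈))) m≤y)
    onto : ∀ {n} → n ∈ positives≤ y → n ∈ map suc⁺ (upTo m)
    onto {mkℕ⁺ (suc k)} n∈ with k ℕ.<? m
    ... | yes k<m = ∈-map⁺ suc⁺ (∈-upTo⁺ k<m)
    ... | no  k≮m = ⊥-elim (≤-<-absurd (fromℤ (+ m ℤ.+ 1ℤ)) y
      (≤-trans (fromℤ (+ m ℤ.+ 1ℤ)) (fromℕ (suc k)) y
        (fromℤ-mono-≤ (ℤ.+≤+ (subst (ℕ._≤ suc k) (ℕ.+-comm 1 m) (ℕ.s≤s (ℕ.≮⇒≥ k≮m)))))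
        (to (∈-positives≤ y (suc⁺ k)) n∈)) y<m+1)

  positives≤-multiples : ∀ x d →
    map (d *⁺_) (positives≤ (x ÷ d)) ↭ filter (λ m → value d ∣? value m) (positives≤ x)
  positives≤-multiples x d = unique∧set⇒↭
    (Unique.map⁺ (*⁺-cancelˡ d) (positives≤-unique (x ÷ d)))
    (Unique.filter⁺ d∣? (positives≤-unique x)) into onto
    where
    d∣? : ∀ m → Dec (value d ∣ value m)
    d∣? m = value d ∣? value m
    into : ∀ {m} → m ∈ map (d *⁺_) (positives≤ (x ÷ d)) → m ∈ filter d∣? (positives≤ x)
    into m∈ with ∈-map⁻ (d *⁺_) m∈
    ... | n , n∈ , refl = ∈-filter⁺ d∣?
      (from (∈-positives≤ x (d *⁺ n)) (subst (λ k → fromℕ k ≤ x) (ℕ.*-comm (value n) (value d))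
        (to (fromℕ-≤-÷ x d (value n)) (to (∈-positives≤ (x ÷ d) n) n∈))))
      (m∣m*n (value n))
    onto : ∀ {m} → m ∈ filter d∣? (positives≤ x) → m ∈ map (d *⁺_) (positives≤ (x ÷ d))
    onto {m} m∈ with ∈-filter⁻ d∣? {xs = positives≤ x} m∈
    -- The quotient must be positive to be a member of the list; it is, because `m` is.
    ... | _   , divides zero m≡0 = contradiction m≡0 (ℕ.≢-nonZero⁻¹ (value m) {{value-≢0 m}})
    ... | m∈x , divides n@(suc _) m≡nd = subst (_∈ map (d *⁺_) (positives≤ (x ÷ d)))
      (sym (value-injective (trans m≡nd (ℕ.*-comm n (value d)))))
      (∈-map⁺ (d *⁺_) (from (∈-positives≤ (x ÷ d) (mkℕ⁺ n))
        (from (fromℕ-≤-÷ x d n) (subst (λ k → fromℕ k ≤ x) m≡nd (to (∈-positives≤ x m) m∈x)))))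

  -- The integer part counts the multiples `m` of `d` up to `x`. The resulting sum has a range
  -- independent of `d`, as the exchange of sums requires.
  μ*⌊÷⌋ : ∀ x → fromℕ 0 ≤ x → ∀ d → μ d ℤ.* ⌊ x ÷ d ⌋ ≡ ∑ (positives≤ x) (λ m → μ∣ m d)
  μ*⌊÷⌋ x 0≤x d = begin
    μ d ℤ.* ⌊ x ÷ d ⌋
      ≡⟨ cong (μ d ℤ.*_) (⌊⌋≡length-positives≤ (x ÷ d) (from (fromℕ-≤-÷ x d 0) 0≤x)) ⟩
    μ d ℤ.* + length (positives≤ (x ÷ d))
      ≡⟨ cong (λ k → μ d ℤ.* + k) (trans (sym (List.length-map (d *⁺_) (positives≤ (x ÷ d)))) (↭-length (positives≤-multiples x d))) ⟩
    μ d ℤ.* + length multiples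
      ≡⟨ sym (∑-const multiples (μ d)) ⟩
    ∑ multiples (λ _ → μ d)
      ≡⟨ ∑-cong-∈ multiples (λ {m} m∈ → sym (μ∣-∣ m d (proj₂ (∈-filter⁻ d∣? {xs = positives≤ x} m∈)))) ⟩
    ∑ multiples (λ m → μ∣ m d)
      ≡⟨ ∑-filter d∣? (positives≤ x) (λ {m} → μ∣-∤ m d) ⟩
    ∑ (positives≤ x) (λ m → μ∣ m d) ∎
    where
    d∣? : ∀ m → Dec (value d ∣ value m)
    d∣? m = value d ∣? value m
    multiples = filter d∣? (positives≤ x)

  positives≤-divisorClosed : ∀ x {m} → m ∈ positives≤ x → DivisorClosed m (positives≤ x)
  positives≤-divisorClosed x {m} m∈ n n∣m = from (∈-positives≤ x n)
    (≤-trans (fromℕ (value n)) (fromℕ (value m)) x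
      (fromℤ-mono-≤ (ℤ.+≤+ (∣⇒≤ {{value-≢0 m}} n∣m))) (to (∈-positives≤ x m) m∈))

theorem1p1 :
    (em : ExcludedMiddle 0ℓ) → let open Classical em in
    (r : ℕ) → 2 ℕ.≤ r →
    (x : ℝ) → fromℕ 1 ≤ x →
    (∑[ ns ∈ tuples r (positives≤ x) ] (μ (∏ ns) ℤ.* ⌊ x ÷ ∏ ns ⌋))
      ≡ (∑[ n ∈ positives≤ x ] ((1ℤ ℤ.- + r) ℤ.^ ω n))
theorem1p1 em r _ x 1≤x = begin
  ∑ (tuples r L) (λ ns → μ (∏ ns) ℤ.* ⌊ x ÷ ∏ ns ⌋)
    ≡⟨ ∑-cong (tuples r L) (λ ns → μ*⌊÷⌋ x 0≤x (∏ ns)) ⟩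
  ∑ (tuples r L) (λ ns → ∑ L (λ m → μ∣ m (∏ ns)))
    ≡⟨ ∑-swap (tuples r L) L (λ ns m → μ∣ m (∏ ns)) ⟩
  ∑ L (λ m → ∑ (tuples r L) (λ ns → μ∣ m (∏ ns)))
    -- Every divisor of some `m ≤ x` is itself at most `x`, so bounding the entries of the tuples by
    -- `x` loses no term for this `m`.
    ≡⟨ ∑-cong-∈ L (λ {m} m∈ → ∑-tuples-μ∣ m L (positives≤-unique x) (positives≤-divisorClosed x m∈) r) ⟩
  ∑ L (λ m → (1ℤ ℤ.- + r) ℤ.^ ω m) ∎
  where
  open Classical em
  open Floor em
  L = positives≤ x
  0≤x : fromℕ 0 ≤ x
  0≤x = ≤-trans (fromℕ 0) (fromℕ 1) x (fromℤ-mono-≤ {0ℤ} {1ℤ} (ℤ.+≤+ ℕ.z≤n)) 1≤x
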